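{- The logic $\mathsf L(\mathfrak G_2)\cap\mathsf L(\mathfrak F_3)$ has nullary unification.
   Context: A frame is a finite poset with a least element; $\mathsf L(\mathfrak F)$ is the set of intuitionistic formulas valid in all Kripke models over $\mathfrak F$. $\mathfrak G_2$: elements $r,a,b,c,d$ with $r<a$, $r<b$, $b<c$, $b<d$ (and transitivity), $a,c,d$ maximal, no other relations. $\mathfrak F_3$ is the 3-fork: a root with three pairwise incomparable maximal elements above it. Unification in a logic $\mathsf L$ is nullary if some $\mathsf L$-unifiable formula has no minimal (w.r.t. inclusion) complete set of unifiers, where a set $\Sigma$ of unifiers of $A$ is complete if every unifier $\mu$ of $A$ satisfies $\alpha\circ\varepsilon=_{\mathsf L}\mu$ for some $\varepsilon\in\Sigma$ and substitution $\alpha$. -}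

module Defs where

open import Data.Nat using (ℕ)
open import Data.Bool using (Bool; true; false)
open import Data.Product using (_×_; Σ; ∃; _,_)
open import Data.Sum using (_⊎_)
open import Data.Empty using (⊥)
open import Relation.Nullary using (¬_)
open import Relation.Binary.PropositionalEquality using (_≡_)
open import Level using (Level; _⊔_) renaming (suc to lsuc; zero to lzero)

data Fm : Set where
  var  : ℕ → Fm
  bot  : Fm
  _∧_  : Fm → Fm → Fm
  _∨_  : Fm → Fm → Fm
  _⇒_  : Fm → Fm → Fm

infixr 6 _∧_
infixr 5 _∨_
infixr 4 _⇒_

_⇔_ : Fm → Fm → Fm
A ⇔ B = (A ⇒ B) ∧ (B ⇒ A)

Subst : Set
Subst = ℕ → Fm

sub : Subst → Fm → Fm
sub σ (var n) = σ n
sub σ bot     = bot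
sub σ (A ∧ B) = sub σ A ∧ sub σ B
sub σ (A ∨ B) = sub σ A ∨ sub σ B
sub σ (A ⇒ B) = sub σ A ⇒ sub σ B

_∘ₛ_ : Subst → Subst → Subst
(α ∘ₛ ε) n = sub α (ε n)

record Frame : Set₁ where
  field
    W   : Set
    _≤_ : W → W → Set

module _ (F : Frame) where
  open Frame F

  Valuation : Set
  Valuation = ℕ → W → Bool

  Monotone : Valuation → Set
  Monotone V = ∀ p w v → w ≤ v → V p w ≡ true → V p v ≡ true

  forces : Valuation → W → Fm → Set
  forces V w (var p) = V p w ≡ true
  forces V w bot     = ⊥
  forces V w (A ∧ B) = forces V w A × forces V w B
  forces V w (A ∨ B) = forces V w A ⊎ forces V w B
  forces V w (A ⇒ B) = ∀ v → w ≤ v → forces V v A → forces V v B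

  ValidIn : Fm → Set
  ValidIn A = ∀ (V : Valuation) → Monotone V → ∀ w → forces V w A

data G₂W : Set where
  r a b c d : G₂W

data _≤G_ : G₂W → G₂W → Set where
  refl≤ : ∀ {x} → x ≤G x
  r≤a : r ≤G a
  r≤b : r ≤G b
  r≤c : r ≤G c
  r≤d : r ≤G d
  b≤c : b ≤G c
  b≤d : b ≤G d

𝔊₂ : Frame
𝔊₂ = record { W = G₂W ; _≤_ = _≤G_ }

data F₃W : Set where
  ρ x₁ x₂ x₃ : F₃W

data _≤F_ : F₃W → F₃W → Set where
  refl≤ : ∀ {x} → x ≤F x
  ρ≤x₁ : ρ ≤F x₁
  ρ≤x₂ : ρ ≤F x₂
  ρ≤x₃ : ρ ≤F x₃

𝔉₃ : Frame
𝔉₃ = record { W = F₃W ; _≤_ = _≤F_ }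

Logic : Set₁
Logic = Fm → Set

L : Logic
L A = ValidIn 𝔊₂ A × ValidIn 𝔉₃ A

module Unification (𝐋 : Logic) where

  Unifier : Fm → Subst → Set
  Unifier A σ = 𝐋 (sub σ A)

  Unifiable : Fm → Set
  Unifiable A = ∃ λ σ → Unifier A σ

  _≈ₗ_ : Subst → Subst → Set
  σ ≈ₗ τ = ∀ n → 𝐋 (σ n ⇔ τ n)

  SubstSet : Set₁
  SubstSet = Subst → Set

  _⊆_ : SubstSet → SubstSet → Set
  S ⊆ T = ∀ σ → S σ → T σ

  Complete : Fm → SubstSet → Set
  Complete A S =
    (∀ ε → S ε → Unifier A ε) ×
    (∀ μ → Unifier A μ → ∃ λ ε → S ε × ∃ λ α → (α ∘ₛ ε) ≈ₗ μ)

  _⊂_ : SubstSet → SubstSet → Set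
  S' ⊂ S = S' ⊆ S × ∃ λ σ → S σ × ¬ S' σ

  MinimalComplete : Fm → SubstSet → Set₁
  MinimalComplete A S = Complete A S × ¬ (Σ SubstSet λ S' → S' ⊂ S × Complete A S')

  Nullary : Set₁
  Nullary = ∃ λ A → Unifiable A × ¬ (Σ SubstSet λ S → MinimalComplete A S)

{-# OPTIONS --safe #-}
module Submission where

-- Take A = ¬¬p ∨ (p ⇒ q ∨ ¬q). Every instance of A holds on 𝔉₃, and refuting an instance on 𝔊₂
-- takes a leaf a without p next to a fork at b that forces p but does not decide q. As a and the
-- fork are independent, a substitution σ for which σ p is not a classical tautology unifies A iff
-- σ p forces σ q ∨ ¬ σ q at the root of every fork. Such a σ may still make p true and q undecided
-- at the root of a 3-fork, but only if its variables tell the three leaves apart. With m variables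
-- σ distinguishes at most 2 ^ m leaves, while above every such unifier τ there is a unifier
-- bump k τ which does this for k pairwise distinguishable leaves; so σ is never more general than
-- bump k τ with k > 2 ^ m. In a complete set S one may therefore drop some such σ, replacing each
-- unifier τ of this kind by a member of S above bump k τ.

open import Defs
open import Data.Bool using (Bool; true; false; _≟_)
open import Data.Empty using (⊥-elim)
open import Data.Fin using (Fin; toℕ; fromℕ<; funToFin; finToFun)
open import Data.Fin.Properties using (pigeonhole; finToFun-funToFin; toℕ<n; toℕ-fromℕ<; 2↔Bool)
open import Data.Fin.Subset using (Subset)
open import Data.Fin.Subset.Properties using (anySubset?)
open import Data.Nat using (ℕ; zero; suc; _+_; _∸_; _^_; _<_; _<?_; _⊔_)
open import Data.Nat.Properties using (<-≤-trans; m≤m⊔n; m≤n⊔m; m+n∸m≡n; n<1+n; <⇒≢; m<1+n⇒m<n∨m≡n)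
  renaming (_≟_ to _≟ℕ_)
open import Data.Product using (_×_; Σ; ∃; _,_; proj₁; proj₂)
open import Data.Product.Function.NonDependent.Propositional using (_×-⇔_)
open import Data.Sum using (_⊎_; inj₁; inj₂)
open import Data.Sum.Function.Propositional using (_⊎-⇔_)
open import Data.Unit using (⊤; tt)
open import Data.Vec using (lookup; tabulate)
open import Data.Vec.Properties using (lookup∘tabulate)
open import Function using (_∘_; _∘′_; id)
open import Function.Bundles using (Equivalence; Inverse; mk⇔) renaming (_⇔_ to _⟺_)
open import Function.Properties.Equivalence using () renaming (refl to ⟺-refl; sym to ⟺-sym; trans to ⟺-trans)
open import Relation.Binary.PropositionalEquality
  using (_≡_; refl; sym; trans; cong; cong₂; subst; module ≡-Reasoning)
open import Relation.Nullary using (¬_; Dec; yes; no; does; contradiction)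
open import Relation.Nullary.Decidable
  using (map′; _×-dec_; _⊎-dec_; _→-dec_; ¬?; does-⇔; dec-true)

open Equivalence using (to; from)
open Unification L

-- Frames with decidable search.

record FinitePoset (F : Frame) : Set₁ where
  open Frame F
  field
    reflexive  : ∀ {w} → w ≤ w
    transitive : ∀ {u v w} → u ≤ v → v ≤ w → u ≤ w
    -- Finiteness enters in this form: it makes forcing decidable, so that later case distinctions
    -- are constructive.
    all≥?      : ∀ w {P : W → Set} → (∀ v → Dec (P v)) → Dec (∀ v → w ≤ v → P v)

open FinitePoset {{...}}

point : Frame
point = record { W = ⊤ ; _≤_ = λ _ _ → ⊤ }

instance
  point-finite : FinitePoset point
  point-finite = record
    { reflexive  = tt
    ; transitive = λ _ _ → tt
    ; all≥?      = λ _ P? → map′ (λ h _ _ → h) (λ h → h tt tt) (P? tt)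
    }

  𝔊₂-finite : FinitePoset 𝔊₂
  𝔊₂-finite = record { reflexive = refl≤ ; transitive = tr ; all≥? = search }
    where
    tr : ∀ {u v w} → u ≤G v → v ≤G w → u ≤G w
    tr refl≤ q     = q
    tr r≤a   refl≤ = r≤a
    tr r≤b   refl≤ = r≤b
    tr r≤b   b≤c   = r≤c
    tr r≤b   b≤d   = r≤d
    tr r≤c   refl≤ = r≤c
    tr r≤d   refl≤ = r≤d
    tr b≤c   refl≤ = b≤c
    tr b≤d   refl≤ = b≤d
    search : ∀ w {P : G₂W → Set} → (∀ v → Dec (P v)) → Dec (∀ v → w ≤G v → P v)
    search r P? = map′
      (λ { (pr , pa , pb , pc , pd) → λ { r _ → pr ; a _ → pa ; b _ → pb ; c _ → pc ; d _ → pd } })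
      (λ h → h r refl≤ , h a r≤a , h b r≤b , h c r≤c , h d r≤d)
      (P? r ×-dec P? a ×-dec P? b ×-dec P? c ×-dec P? d)
    search a P? = map′ (λ { pa .a refl≤ → pa }) (λ h → h a refl≤) (P? a)
    search b P? = map′
      (λ { (pb , pc , pd) → λ { .b refl≤ → pb ; .c b≤c → pc ; .d b≤d → pd } })
      (λ h → h b refl≤ , h c b≤c , h d b≤d)
      (P? b ×-dec P? c ×-dec P? d)
    search c P? = map′ (λ { pc .c refl≤ → pc }) (λ h → h c refl≤) (P? c)
    search d P? = map′ (λ { pd .d refl≤ → pd }) (λ h → h d refl≤) (P? d)

  𝔉₃-finite : FinitePoset 𝔉₃
  𝔉₃-finite = record { reflexive = refl≤ ; transitive = tr ; all≥? = search }
    where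
    tr : ∀ {u v w} → u ≤F v → v ≤F w → u ≤F w
    tr refl≤ q     = q
    tr ρ≤x₁  refl≤ = ρ≤x₁
    tr ρ≤x₂  refl≤ = ρ≤x₂
    tr ρ≤x₃  refl≤ = ρ≤x₃
    search : ∀ w {P : F₃W → Set} → (∀ v → Dec (P v)) → Dec (∀ v → w ≤F v → P v)
    search ρ P? = map′
      (λ { (p0 , p1 , p2 , p3) → λ { ρ _ → p0 ; x₁ _ → p1 ; x₂ _ → p2 ; x₃ _ → p3 } })
      (λ h → h ρ refl≤ , h x₁ ρ≤x₁ , h x₂ ρ≤x₂ , h x₃ ρ≤x₃)
      (P? ρ ×-dec P? x₁ ×-dec P? x₂ ×-dec P? x₃)
    search x₁ P? = map′ (λ { p .x₁ refl≤ → p }) (λ h → h x₁ refl≤) (P? x₁)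
    search x₂ P? = map′ (λ { p .x₂ refl≤ → p }) (λ h → h x₂ refl≤) (P? x₂)
    search x₃ P? = map′ (λ { p .x₃ refl≤ → p }) (λ h → h x₃ refl≤) (P? x₃)

neg : Fm → Fm
neg φ = φ ⇒ bot

verum : Fm
verum = bot ⇒ bot

forces? : ∀ F {{_ : FinitePoset F}} V w φ → Dec (forces F V w φ)
forces? F V w (var n) = V n w ≟ true
forces? F V w bot     = no λ ()
forces? F V w (φ ∧ ψ) = forces? F V w φ ×-dec forces? F V w ψ
forces? F V w (φ ∨ ψ) = forces? F V w φ ⊎-dec forces? F V w ψ
forces? F V w (φ ⇒ ψ) = all≥? w λ v → forces? F V v φ →-dec forces? F V v ψ

persistent : ∀ F {{_ : FinitePoset F}} {V} → Monotone F V →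
  ∀ φ {w v} → Frame._≤_ F w v → forces F V w φ → forces F V v φ
persistent F mono (var n) w≤v h        = mono n _ _ w≤v h
persistent F mono (φ ∧ ψ) w≤v (h , k)  = persistent F mono φ w≤v h , persistent F mono ψ w≤v k
persistent F mono (φ ∨ ψ) w≤v (inj₁ h) = inj₁ (persistent F mono φ w≤v h)
persistent F mono (φ ∨ ψ) w≤v (inj₂ h) = inj₂ (persistent F mono ψ w≤v h)
persistent F mono (φ ⇒ ψ) w≤v h        = λ u v≤u → h u (transitive w≤v v≤u)

-- Variables occurring in a formula.

data AllVars (P : ℕ → Set) : Fm → Set where
  var : ∀ {n} → P n → AllVars P (var n)
  bot : AllVars P bot
  _∧_ : ∀ {φ ψ} → AllVars P φ → AllVars P ψ → AllVars P (φ ∧ ψ)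
  _∨_ : ∀ {φ ψ} → AllVars P φ → AllVars P ψ → AllVars P (φ ∨ ψ)
  _⇒_ : ∀ {φ ψ} → AllVars P φ → AllVars P ψ → AllVars P (φ ⇒ ψ)

AllVars-map : ∀ {P Q : ℕ → Set} → (∀ {n} → P n → Q n) → ∀ {φ} → AllVars P φ → AllVars Q φ
AllVars-map f (var p) = var (f p)
AllVars-map f bot     = bot
AllVars-map f (p ∧ q) = AllVars-map f p ∧ AllVars-map f q
AllVars-map f (p ∨ q) = AllVars-map f p ∨ AllVars-map f q
AllVars-map f (p ⇒ q) = AllVars-map f p ⇒ AllVars-map f q

allVars : ∀ {P : ℕ → Set} → (∀ n → P n) → ∀ φ → AllVars P φ
allVars f (var n) = var (f n)
allVars f bot     = bot
allVars f (φ ∧ ψ) = allVars f φ ∧ allVars f ψ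
allVars f (φ ∨ ψ) = allVars f φ ∨ allVars f ψ
allVars f (φ ⇒ ψ) = allVars f φ ⇒ allVars f ψ

bound : Fm → ℕ
bound (var n) = suc n
bound bot     = 0
bound (φ ∧ ψ) = bound φ ⊔ bound ψ
bound (φ ∨ ψ) = bound φ ⊔ bound ψ
bound (φ ⇒ ψ) = bound φ ⊔ bound ψ

allVars<bound : ∀ φ → AllVars (_< bound φ) φ

allVars<⊔ˡ : ∀ φ k → AllVars (_< bound φ ⊔ k) φ
allVars<⊔ˡ φ k = AllVars-map (λ lt → <-≤-trans lt (m≤m⊔n _ k)) (allVars<bound φ)

allVars<⊔ʳ : ∀ k φ → AllVars (_< k ⊔ bound φ) φ
allVars<⊔ʳ k φ = AllVars-map (λ lt → <-≤-trans lt (m≤n⊔m k _)) (allVars<bound φ)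

allVars<bound (var n) = var (n<1+n n)
allVars<bound bot     = bot
allVars<bound (φ ∧ ψ) = allVars<⊔ˡ φ (bound ψ) ∧ allVars<⊔ʳ (bound φ) ψ
allVars<bound (φ ∨ ψ) = allVars<⊔ˡ φ (bound ψ) ∨ allVars<⊔ʳ (bound φ) ψ
allVars<bound (φ ⇒ ψ) = allVars<⊔ˡ φ (bound ψ) ⇒ allVars<⊔ʳ (bound φ) ψ

-- Bisimulations and classical truth at maximal points.

record Bisimulation (F G : Frame) (Z : Frame.W F → Frame.W G → Set) : Set where
  field
    forth : ∀ {w w′ v} → Z w w′ → Frame._≤_ F w v → ∃ λ v′ → Frame._≤_ G w′ v′ × Z v v′
    back  : ∀ {w w′ v′} → Z w w′ → Frame._≤_ G w′ v′ → ∃ λ v → Frame._≤_ F w v × Z v v′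

open Bisimulation

-- The valuations have to match only on the variables of `φ`; this is what later allows two leaves
-- of a 3-fork to be identified.
bisimilar : ∀ {F G Z} → Bisimulation F G Z → ∀ {V U φ} →
  AllVars (λ n → ∀ {w w′} → Z w w′ → V n w ≡ U n w′) φ →
  ∀ {w w′} → Z w w′ → forces F V w φ ⟺ forces G U w′ φ
bisimilar B (var e) z = mk⇔ (trans (sym (e z))) (trans (e z))
bisimilar B bot     z = ⟺-refl
bisimilar B (p ∧ q) z = bisimilar B p z ×-⇔ bisimilar B q z
bisimilar B (p ∨ q) z = bisimilar B p z ⊎-⇔ bisimilar B q z
bisimilar B (p ⇒ q) z = mk⇔
  (λ h v′ le x → let v , w≤v , zv = back B z le in
    to (bisimilar B q zv) (h v w≤v (from (bisimilar B p zv) x)))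
  (λ h v le x → let v′ , w≤v′ , zv = forth B z le in
    from (bisimilar B q zv) (h v′ w≤v′ (to (bisimilar B p zv) x)))

Classical : (ℕ → Bool) → Fm → Set
Classical v = forces point (λ n _ → v n) tt

classical? : ∀ v φ → Dec (Classical v φ)
classical? v = forces? point (λ n _ → v n) tt

Classical-cong : ∀ {u v φ} → AllVars (λ n → u n ≡ v n) φ → Classical u φ ⟺ Classical v φ
Classical-cong e = bisimilar {Z = λ _ _ → ⊤}
  (record { forth = λ _ _ → tt , tt , tt ; back = λ _ _ → tt , tt , tt })
  (AllVars-map (λ p {_} {_} _ → p) e) tt

maximal⟺Classical : ∀ F {{_ : FinitePoset F}} V {w} →
  (∀ u → Frame._≤_ F w u → u ≡ w) → ∀ φ → forces F V w φ ⟺ Classical (λ n → V n w) φ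
maximal⟺Classical F V {w} max φ = bisimilar {F = F} {Z = λ u _ → u ≡ w}
  (record { forth = λ { refl le → tt , tt , max _ le }
          ; back  = λ { refl _ → w , reflexive , refl } })
  (allVars (λ { n refl → refl }) φ) refl

-- Substitutions as changes of valuation, and the generality order.

pull : ∀ F {{_ : FinitePoset F}} → Subst → Valuation F → Valuation F
pull F α V n w = does (forces? F V w (α n))

does-true : ∀ {P : Set} (P? : Dec P) → (does P? ≡ true) ⟺ P
does-true (yes p) = mk⇔ (λ _ → p) (λ _ → refl)
does-true (no ¬p) = mk⇔ (λ ()) (λ p → ⊥-elim (¬p p))

forces-sub : ∀ F α {V U : Valuation F} → (∀ n w → (U n w ≡ true) ⟺ forces F V w (α n)) →
  ∀ φ w → forces F V w (sub α φ) ⟺ forces F U w φ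
forces-sub F α e (var n) w = ⟺-sym (e n w)
forces-sub F α e bot     w = ⟺-refl
forces-sub F α e (φ ∧ ψ) w = forces-sub F α e φ w ×-⇔ forces-sub F α e ψ w
forces-sub F α e (φ ∨ ψ) w = forces-sub F α e φ w ⊎-⇔ forces-sub F α e ψ w
forces-sub F α e (φ ⇒ ψ) w = mk⇔
  (λ h v le x → to (forces-sub F α e ψ v) (h v le (from (forces-sub F α e φ v) x)))
  (λ h v le x → from (forces-sub F α e ψ v) (h v le (to (forces-sub F α e φ v) x)))

forces-pull : ∀ F {{_ : FinitePoset F}} α V φ w →
  forces F V w (sub α φ) ⟺ forces F (pull F α V) w φ
forces-pull F α V = forces-sub F α λ n w → does-true (forces? F V w (α n))

pull-monotone : ∀ F {{_ : FinitePoset F}} α {V} → Monotone F V → Monotone F (pull F α V)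
pull-monotone F α {V} mono n w v w≤v h =
  from (does-true (forces? F V v (α n)))
    (persistent F mono (α n) w≤v (to (does-true (forces? F V w (α n))) h))

sub-∘ : ∀ α β φ → sub (α ∘ₛ β) φ ≡ sub α (sub β φ)
sub-∘ α β (var n) = refl
sub-∘ α β bot     = refl
sub-∘ α β (φ ∧ ψ) = cong₂ _∧_ (sub-∘ α β φ) (sub-∘ α β ψ)
sub-∘ α β (φ ∨ ψ) = cong₂ _∨_ (sub-∘ α β φ) (sub-∘ α β ψ)
sub-∘ α β (φ ⇒ ψ) = cong₂ _⇒_ (sub-∘ α β φ) (sub-∘ α β ψ)

sub-id : ∀ {α} → (∀ n → α n ≡ var n) → ∀ φ → sub α φ ≡ φ
sub-id e (var n) = e n
sub-id e bot     = refl
sub-id e (φ ∧ ψ) = cong₂ _∧_ (sub-id e φ) (sub-id e ψ)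
sub-id e (φ ∨ ψ) = cong₂ _∨_ (sub-id e φ) (sub-id e ψ)
sub-id e (φ ⇒ ψ) = cong₂ _⇒_ (sub-id e φ) (sub-id e ψ)

ValidIn-sub : ∀ F {{_ : FinitePoset F}} α φ → ValidIn F φ → ValidIn F (sub α φ)
ValidIn-sub F α φ h V mono w =
  from (forces-pull F α V φ w) (h (pull F α V) (pull-monotone F α mono) w)

L-sub : ∀ α φ → L φ → L (sub α φ)
L-sub α φ (g , f) = ValidIn-sub 𝔊₂ α φ g , ValidIn-sub 𝔉₃ α φ f

L-⇔-refl : ∀ φ → L (φ ⇔ φ)
L-⇔-refl φ = (λ _ _ _ → (λ _ _ → id) , (λ _ _ → id)) , (λ _ _ _ → (λ _ _ → id) , (λ _ _ → id))

ValidIn-⇔-trans : ∀ F φ ψ χ → ValidIn F (φ ⇔ ψ) → ValidIn F (ψ ⇔ χ) → ValidIn F (φ ⇔ χ)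
ValidIn-⇔-trans F φ ψ χ h k V mono w =
  (λ v le → proj₁ (k V mono w) v le ∘′ proj₁ (h V mono w) v le) ,
  (λ v le → proj₂ (h V mono w) v le ∘′ proj₂ (k V mono w) v le)

L-⇔-trans : ∀ φ ψ χ → L (φ ⇔ ψ) → L (ψ ⇔ χ) → L (φ ⇔ χ)
L-⇔-trans φ ψ χ (g , f) (g′ , f′) =
  ValidIn-⇔-trans 𝔊₂ φ ψ χ g g′ , ValidIn-⇔-trans 𝔉₃ φ ψ χ f f′

infix 4 _≽_

_≽_ : Subst → Subst → Set
ε ≽ μ = ∃ λ α → (α ∘ₛ ε) ≈ₗ μ

≽-trans : ∀ {ε β μ} → ε ≽ β → β ≽ μ → ε ≽ μ
≽-trans {ε} {β} {μ} (α′ , e′) (α , e) = α ∘ₛ α′ , λ n →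
  subst (λ φ → L (φ ⇔ μ n)) (sym (sub-∘ α α′ (ε n)))
    (L-⇔-trans (sub α (sub α′ (ε n))) (sub α (β n)) (μ n)
      (L-sub α (sub α′ (ε n) ⇔ β n) (e′ n)) (e n))

-- The formula `target` and its unifiers.

schema : Fm → Fm → Fm
schema P Q = neg (neg P) ∨ (P ⇒ Q ∨ neg Q)

target : Fm
target = schema (var 0) (var 1)

maximal-decides : ∀ F {{_ : FinitePoset F}} V {w} → (∀ u → Frame._≤_ F w u → u ≡ w) →
  ∀ Q → forces F V w (Q ∨ neg Q)
maximal-decides F V {w} max Q with forces? F V w Q
... | yes h = inj₁ h
... | no ¬h = inj₂ λ u le h → ¬h (subst (λ v → forces F V v Q) (max u le) h)

¬¬-intro : ∀ F {{_ : FinitePoset F}} {V} → Monotone F V →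
  ∀ φ w → forces F V w φ → forces F V w (neg (neg φ))
¬¬-intro F mono φ w h v le k = k v reflexive (persistent F mono φ le h)

-- Where `neg (neg P)` fails, so does `P`. Hence only leaves remain to be checked for the
-- implication, and a leaf decides every formula.
𝔉₃⊨schema : ∀ P Q → ValidIn 𝔉₃ (schema P Q)
𝔉₃⊨schema P Q V mono w with forces? 𝔉₃ V w (neg (neg P))
... | yes h = inj₁ h
... | no ¬h = inj₂ λ
  { ρ  refl≤ h → ⊥-elim (¬h (¬¬-intro 𝔉₃ mono P ρ h))
  ; x₁ _ _ → maximal-decides 𝔉₃ V (λ { _ refl≤ → refl }) Q
  ; x₂ _ _ → maximal-decides 𝔉₃ V (λ { _ refl≤ → refl }) Q
  ; x₃ _ _ → maximal-decides 𝔉₃ V (λ { _ refl≤ → refl }) Q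
  }

-- The points `b`, `c`, `d` form a fork with two leaves, and forcing at `b` depends on nothing else.
ForkDecides : Fm → Fm → Set
ForkDecides P Q = ∀ V → Monotone 𝔊₂ V → forces 𝔊₂ V b P → forces 𝔊₂ V b (Q ∨ neg Q)

𝔊₂⊨schema : ∀ P Q → ForkDecides P Q → ValidIn 𝔊₂ (schema P Q)
𝔊₂⊨schema P Q dec V mono w with forces? 𝔊₂ V w (neg (neg P))
... | yes h = inj₁ h
... | no ¬h = inj₂ λ
  { r refl≤ h → ⊥-elim (¬h (¬¬-intro 𝔊₂ mono P r h))
  ; a _ _ → maximal-decides 𝔊₂ V (λ { _ refl≤ → refl }) Q
  ; b _ h → dec V mono h
  ; c _ _ → maximal-decides 𝔊₂ V (λ { _ refl≤ → refl }) Q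
  ; d _ _ → maximal-decides 𝔊₂ V (λ { _ refl≤ → refl }) Q
  }

ForkDecides⇒Unifier : ∀ σ → ForkDecides (σ 0) (σ 1) → Unifier target σ
ForkDecides⇒Unifier σ dec = 𝔊₂⊨schema (σ 0) (σ 1) dec , 𝔉₃⊨schema (σ 0) (σ 1)

-- This combines an arbitrary classical valuation at `a` with a given fork at `b`; falsity at `r`
-- keeps the result monotone.
graft : (ℕ → Bool) → Valuation 𝔊₂ → Valuation 𝔊₂
graft v V n r = false
graft v V n a = v n
graft v V n b = V n b
graft v V n c = V n c
graft v V n d = V n d

graft-monotone : ∀ v {V} → Monotone 𝔊₂ V → Monotone 𝔊₂ (graft v V)
graft-monotone v mono n w _ refl≤ h = h
graft-monotone v mono n _ _ b≤c h = mono n b c b≤c h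
graft-monotone v mono n _ _ b≤d h = mono n b d b≤d h

data AboveB : G₂W → G₂W → Set where
  at-b : AboveB b b
  at-c : AboveB c c
  at-d : AboveB d d

graft-above-b : ∀ v V φ {w} → AboveB w w → forces 𝔊₂ V w φ ⟺ forces 𝔊₂ (graft v V) w φ
graft-above-b v V φ = bisimilar
  (record { forth = forth′ ; back = back′ })
  (allVars (λ n → λ { at-b → refl ; at-c → refl ; at-d → refl }) φ)
  where
  forth′ : ∀ {w w′ u} → AboveB w w′ → w ≤G u → ∃ λ u′ → w′ ≤G u′ × AboveB u u′
  forth′ z    refl≤ = _ , refl≤ , z
  forth′ at-b b≤c   = c , b≤c , at-c
  forth′ at-b b≤d   = d , b≤d , at-d
  back′ : ∀ {w w′ u′} → AboveB w w′ → w′ ≤G u′ → ∃ λ u → w ≤G u × AboveB u u′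
  back′ z    refl≤ = _ , refl≤ , z
  back′ at-b b≤c   = c , b≤c , at-c
  back′ at-b b≤d   = d , b≤d , at-d

Refutable : Fm → Set
Refutable φ = ∃ λ v → ¬ Classical v φ

refutable-unifier⇒ForkDecides : ∀ σ → Unifier target σ → Refutable (σ 0) → ForkDecides (σ 0) (σ 1)
refutable-unifier⇒ForkDecides σ (valid , _) (v , v⊮) V mono h
  with valid (graft v V) (graft-monotone v mono) r
-- The leaf `a` carries the refuting valuation, so it forces the negation of `σ 0`, and the first
-- disjunct fails at `r`.
... | inj₁ ¬¬P = ⊥-elim (¬¬P a r≤a λ { _ refl≤ p →
        v⊮ (to (maximal⟺Classical 𝔊₂ (graft v V) (λ { _ refl≤ → refl }) (σ 0)) p) })
... | inj₂ dec = from (graft-above-b v V (σ 1 ∨ neg (σ 1)) at-b)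
        (dec b r≤b (to (graft-above-b v V (σ 0) at-b) h))

ext : ∀ {m} → Subset m → ℕ → Bool
ext {m} xs n with n <? m
... | yes n<m = lookup xs (fromℕ< n<m)
... | no _    = false

ext-tabulate : ∀ {m} (v : ℕ → Bool) {n} → n < m → v n ≡ ext {m} (tabulate (v ∘ toℕ)) n
ext-tabulate {m} v {n} n<m with n <? m
... | yes p = sym (trans (lookup∘tabulate (v ∘ toℕ) (fromℕ< p)) (cong v (toℕ-fromℕ< p)))
... | no ¬p = contradiction n<m ¬p

-- Only variables below `bound φ` influence the truth value, so it suffices to search the finitely
-- many subsets of them.
refutable? : ∀ φ → Dec (Refutable φ)
refutable? φ = map′ (λ { (xs , h) → ext xs , h })
  (λ { (v , h) → tabulate (v ∘ toℕ) , λ k → h (from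
    (Classical-cong {φ = φ} (AllVars-map (ext-tabulate v) (allVars<bound φ))) k) })
  (anySubset? {n = bound φ} λ xs → ¬? (classical? (ext xs) φ))

-- The more general unifiers `bump k τ`.

select : Fm → Fm → Fm → Fm
select γ φ ψ = (γ ∧ φ) ∨ (neg γ ∧ ψ)

select-verum : ∀ F {{_ : FinitePoset F}} φ ψ → ValidIn F (select verum φ ψ ⇔ φ)
select-verum F φ ψ V mono w =
  (λ { v le (inj₁ (_ , h)) → h ; v le (inj₂ (h , _)) → ⊥-elim (h v reflexive λ _ _ → id) }) ,
  (λ v le h → inj₁ ((λ _ _ → id) , h))

⋀ : (ℕ → Fm) → ℕ → Fm
⋀ φ zero    = verum
⋀ φ (suc k) = ⋀ φ k ∧ φ k

⋀-intro : ∀ F {V w} φ k → (∀ i → forces F V w (φ i)) → forces F V w (⋀ φ k)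
⋀-intro F φ zero    h = λ _ _ → id
⋀-intro F φ (suc k) h = ⋀-intro F φ k h , h k

⋀-elim : ∀ F {V w} φ k → forces F V w (⋀ φ k) → ∀ {i} → i < k → forces F V w (φ i)
⋀-elim F φ (suc k) (h , hk) i<1+k with m<1+n⇒m<n∨m≡n i<1+k
... | inj₁ i<k  = ⋀-elim F φ k h i<k
... | inj₂ refl = hk

guard mark : Fm
guard = var 0
mark  = var 1

label : ℕ → Fm
label i = var (2 + i)

-- On a fork, agree i says that all marked leaves carry label i or none of them does.
agree : ℕ → Fm
agree i = neg (mark ∧ label i) ∨ neg (mark ∧ neg (label i))

weakDec : Fm
weakDec = neg mark ∨ neg (neg mark)

-- Fails at the root of a fork with two leaves of which one is marked, but holds at the root of
-- a 3-fork in which two differently labelled leaves are marked and the third is not.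
splits : ℕ → Fm
splits k = ⋀ agree k ⇒ weakDec

-- The variables of `τ` are moved past the guard, the mark and the `k` labels.
shift : ℕ → Subst
shift k n = var (2 + k + n)

unshift : ℕ → Subst
unshift k zero    = verum
-- The mark and the labels are cut off to `var 0`; in `bump` they occur only in the branch that a
-- true guard switches off.
unshift k (suc n) = var (n ∸ suc k)

unshift-shift : ∀ k φ → sub (unshift k) (sub (shift k) φ) ≡ φ
unshift-shift k φ = trans (sym (sub-∘ (unshift k) (shift k) φ))
  (sub-id (λ n → cong var (m+n∸m≡n k n)) φ)

bump : ℕ → Subst → Subst
bump k τ 0             = select guard (sub (shift k) (τ 0)) (splits k)
bump k τ 1             = select guard (sub (shift k) (τ 1)) (neg (neg mark))
bump k τ (suc (suc n)) = sub (shift k) (τ (2 + n))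

-- Making the guard true selects the shifted copy of `τ`, and `unshift` undoes the shift.
bump≽ : ∀ k τ → bump k τ ≽ τ
bump≽ k τ = unshift k , e
  where
  guarded : ∀ φ ψ → L (sub (unshift k) (select guard (sub (shift k) φ) ψ) ⇔ φ)
  guarded φ ψ = subst (λ χ → L (select verum χ (sub (unshift k) ψ) ⇔ φ))
    (sym (unshift-shift k φ))
    (select-verum 𝔊₂ φ (sub (unshift k) ψ) , select-verum 𝔉₃ φ (sub (unshift k) ψ))
  e : (unshift k ∘ₛ bump k τ) ≈ₗ τ
  e 0 = guarded (τ 0) (splits k)
  e 1 = guarded (τ 1) (neg (neg mark))
  e (suc (suc n)) = subst (λ χ → L (χ ⇔ τ (2 + n))) (sym (unshift-shift k (τ (2 + n))))
    (L-⇔-refl (τ (2 + n)))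

-- With no marked point other than `x`, the label of `x` alone determines which disjunct of
-- `agree i` holds.
single-mark⇒agree : ∀ {V} x → (∀ u → x ≤G u → u ≡ x) →
  (∀ u → b ≤G u → V 1 u ≡ true → u ≡ x) → ∀ i → forces 𝔊₂ V b (agree i)
single-mark⇒agree {V} x max only i with V (2 + i) x ≟ true
... | yes lx = inj₂ λ u b≤u (m , ¬l) →
        ¬l u refl≤ (subst (λ w → V (2 + i) w ≡ true) (sym (only u b≤u m)) lx)
... | no ¬lx = inj₁ λ u b≤u (m , l) → ¬lx (subst (λ w → V (2 + i) w ≡ true) (only u b≤u m) l)

-- If both leaves or neither are marked, `weakDec` holds outright. If exactly one is, every
-- `agree i` holds, and the implication `splits k` yields `weakDec`.
splits⇒weakDec : ∀ k V → Monotone 𝔊₂ V → forces 𝔊₂ V b (splits k) → forces 𝔊₂ V b weakDec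
splits⇒weakDec k V mono h with V 1 c in mc | V 1 d in md
... | true  | true  = inj₂ λ
  { b _ n → n c b≤c mc ; c _ n → n c refl≤ mc ; d _ n → n d refl≤ md }
... | false | false = inj₁ λ
  { b _ m → contradiction (trans (sym mc) (mono 1 b c b≤c m)) λ ()
  ; c _ m → contradiction (trans (sym mc) m) λ ()
  ; d _ m → contradiction (trans (sym md) m) λ ()
  }
... | true  | false = h b refl≤ (⋀-intro 𝔊₂ agree k (single-mark⇒agree {V} c (λ { _ refl≤ → refl }) λ
  { b _ m → contradiction (trans (sym md) (mono 1 b d b≤d m)) λ ()
  ; c _ _ → refl
  ; d _ m → contradiction (trans (sym md) m) λ ()
  }))
... | false | true  = h b refl≤ (⋀-intro 𝔊₂ agree k (single-mark⇒agree {V} d (λ { _ refl≤ → refl }) λ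
  { b _ m → contradiction (trans (sym mc) (mono 1 b c b≤c m)) λ ()
  ; c _ m → contradiction (trans (sym mc) m) λ ()
  ; d _ _ → refl
  }))

-- The disjunct of `select` forced at `b` settles the guard on the whole fork. A true guard reduces
-- the claim to `τ` under the pulled-back valuation; a false one leaves `neg (neg mark)`, which
-- `weakDec` decides.
bump-ForkDecides : ∀ k τ → ForkDecides (τ 0) (τ 1) → ForkDecides (bump k τ 0) (bump k τ 1)
bump-ForkDecides k τ dec V mono (inj₁ (g , h))
  with dec (pull 𝔊₂ (shift k) V) (pull-monotone 𝔊₂ (shift k) mono)
         (to (forces-pull 𝔊₂ (shift k) V (τ 0) b) h)
... | inj₁ q  = inj₁ (inj₁ (g , from (forces-pull 𝔊₂ (shift k) V (τ 1) b) q))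
... | inj₂ ¬q = inj₂ λ
  { v le (inj₁ (_ , q)) → from (forces-pull 𝔊₂ (shift k) V (neg (τ 1)) b) ¬q v le q
  ; v le (inj₂ (¬g , _)) → ¬g v refl≤ (mono 0 b v le g)
  }
bump-ForkDecides k τ dec V mono (inj₂ (¬g , h)) with splits⇒weakDec k V mono h
... | inj₁ ¬m  = inj₂ λ
  { v le (inj₁ (g , _)) → ¬g v le g
  ; v le (inj₂ (_ , ¬¬m)) → ¬¬m v refl≤ λ u v≤u → ¬m u (transitive le v≤u)
  }
... | inj₂ ¬¬m = inj₁ (inj₂ (¬g , ¬¬m))

-- Folding a 3-fork onto a fork.

data Fold : F₃W → G₂W → Set where
  ρ~b  : Fold ρ b
  x₁~c : Fold x₁ c
  x₂~c : Fold x₂ c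
  x₃~d : Fold x₃ d

fold-bisimulation : Bisimulation 𝔉₃ 𝔊₂ Fold
fold-bisimulation = record { forth = forth′ ; back = back′ }
  where
  forth′ : ∀ {w w′ v} → Fold w w′ → w ≤F v → ∃ λ v′ → w′ ≤G v′ × Fold v v′
  forth′ z   refl≤ = _ , refl≤ , z
  forth′ ρ~b ρ≤x₁  = c , b≤c , x₁~c
  forth′ ρ~b ρ≤x₂  = c , b≤c , x₂~c
  forth′ ρ~b ρ≤x₃  = d , b≤d , x₃~d
  back′ : ∀ {w w′ v′} → Fold w w′ → w′ ≤G v′ → ∃ λ v → w ≤F v × Fold v v′
  back′ z   refl≤ = _ , refl≤ , z
  back′ ρ~b b≤c   = x₁ , ρ≤x₁ , x₁~c
  back′ ρ~b b≤d   = x₃ , ρ≤x₃ , x₃~d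

fold : Valuation 𝔉₃ → Valuation 𝔊₂
fold V n r = false
fold V n a = false
fold V n b = V n ρ
fold V n c = V n x₁
fold V n d = V n x₃

fold-monotone : ∀ {V} → Monotone 𝔉₃ V → Monotone 𝔊₂ (fold V)
fold-monotone mono n _ _ refl≤ h = h
fold-monotone mono n _ _ b≤c   h = mono n ρ x₁ ρ≤x₁ h
fold-monotone mono n _ _ b≤d   h = mono n ρ x₃ ρ≤x₃ h

forces-fold : ∀ V φ → AllVars (λ n → V n x₁ ≡ V n x₂) φ →
  forces 𝔉₃ V ρ φ ⟺ forces 𝔊₂ (fold V) b φ
forces-fold V φ e = bisimilar fold-bisimulation
  (AllVars-map (λ e → λ { ρ~b → refl ; x₁~c → refl ; x₂~c → sym e ; x₃~d → refl }) e) ρ~b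

-- When `P` and `Q` cannot tell `x₁` from `x₂`, mapping both to `c` is a bisimulation for these
-- formulas, so the decision on the fork transfers back.
ForkDecides-3fork : ∀ P Q → ForkDecides P Q → ∀ V → Monotone 𝔉₃ V →
  AllVars (λ n → V n x₁ ≡ V n x₂) P → AllVars (λ n → V n x₁ ≡ V n x₂) Q →
  forces 𝔉₃ V ρ P → forces 𝔉₃ V ρ (Q ∨ neg Q)
ForkDecides-3fork P Q dec V mono eP eQ h =
  from (forces-fold V (Q ∨ neg Q) (eQ ∨ (eQ ⇒ bot)))
    (dec (fold V) (fold-monotone mono) (to (forces-fold V P eP) h))

pull-maximal : ∀ F {{_ : FinitePoset F}} α V {w} → (∀ u → Frame._≤_ F w u → u ≡ w) →
  ∀ n → pull F α V n w ≡ does (classical? (λ k → V k w) (α n))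
pull-maximal F α V {w} max n =
  does-⇔ (maximal⟺Classical F V max (α n)) (forces? F V w (α n)) (classical? _ (α n))

-- A 3-fork on which `bump k τ` leaves its second value undecided.

tripod : (l₁ l₂ l₃ : ℕ → Bool) → Valuation 𝔉₃
tripod l₁ l₂ l₃ n ρ  = false
tripod l₁ l₂ l₃ n x₁ = l₁ n
tripod l₁ l₂ l₃ n x₂ = l₂ n
tripod l₁ l₂ l₃ n x₃ = l₃ n

tripod-monotone : ∀ l₁ l₂ l₃ → Monotone 𝔉₃ (tripod l₁ l₂ l₃)
tripod-monotone l₁ l₂ l₃ n w _ refl≤ h = h

labelled : ℕ → ℕ → Bool
labelled i 0             = false
labelled i 1             = true
labelled i (suc (suc n)) = does (n ≟ℕ i)

blank : ℕ → Bool
blank _ = false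

tripod-splits : ∀ k {i j} → i < k → ¬ i ≡ j →
  forces 𝔉₃ (tripod (labelled i) (labelled j) blank) ρ (splits k)
tripod-splits k {i} {j} i<k i≢j = λ
  -- Of the two marked leaves only `x₁` carries label `i`, so the root refutes `agree i`. The leaves
  -- force `weakDec` by themselves.
  { ρ _ h → ⊥-elim (disagree (⋀-elim 𝔉₃ agree k h i<k))
  ; x₁ _ _ → inj₂ λ { _ refl≤ n → n x₁ refl≤ refl }
  ; x₂ _ _ → inj₂ λ { _ refl≤ n → n x₂ refl≤ refl }
  ; x₃ _ _ → inj₁ λ { _ refl≤ () }
  }
  where
  disagree : ¬ forces 𝔉₃ (tripod (labelled i) (labelled j) blank) ρ (agree i)
  disagree (inj₁ h) = h x₁ ρ≤x₁ (refl , dec-true (i ≟ℕ i) refl)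
  disagree (inj₂ h) = h x₂ ρ≤x₂ (refl , λ { _ refl≤ e → i≢j (to (does-true (i ≟ℕ j)) e) })

tripod-bump : ∀ k τ {i j} → i < k → ¬ i ≡ j →
  let V = tripod (labelled i) (labelled j) blank in
  forces 𝔉₃ V ρ (bump k τ 0) × ¬ forces 𝔉₃ V ρ (bump k τ 1 ∨ neg (bump k τ 1))
tripod-bump k τ {i} {j} i<k i≢j = inj₂ (¬guard , tripod-splits k i<k i≢j) , undecided
  where
  V : Valuation 𝔉₃
  V = tripod (labelled i) (labelled j) blank
  ¬guard : forces 𝔉₃ V ρ (neg guard)
  ¬guard ρ _ ()
  ¬guard x₁ _ ()
  ¬guard x₂ _ ()
  ¬guard x₃ _ ()
  undecided : ¬ forces 𝔉₃ V ρ (bump k τ 1 ∨ neg (bump k τ 1))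
  -- The unmarked leaf `x₃` rules out `neg (neg mark)` at the root; the marked leaf `x₁` rules out
  -- the negation of `bump k τ 1`.
  undecided (inj₁ (inj₂ (_ , h))) = h x₃ ρ≤x₃ λ { _ refl≤ () }
  undecided (inj₂ h) = h x₁ ρ≤x₁
    (inj₂ ((λ v le → ¬guard v (transitive ρ≤x₁ le)) , λ { _ refl≤ n → n x₁ refl≤ refl }))

-- Counting the leaves that a substitution distinguishes.

encode : ∀ {m} → (Fin m → Bool) → Fin (2 ^ m)
encode f = funToFin (Inverse.from 2↔Bool ∘ f)

encode-injective : ∀ {m} (f g : Fin m → Bool) → encode f ≡ encode g → ∀ n → f n ≡ g n
encode-injective f g e n = begin
  f n                                             ≡⟨ decode f ⟨
  Inverse.to 2↔Bool (finToFun (encode f) n)       ≡⟨ cong (λ x → Inverse.to 2↔Bool (finToFun x n)) e ⟩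
  Inverse.to 2↔Bool (finToFun (encode g) n)       ≡⟨ decode g ⟩
  g n                                             ∎
  where
  open ≡-Reasoning
  decode : ∀ h → Inverse.to 2↔Bool (finToFun (encode h) n) ≡ h n
  decode h = trans (cong (Inverse.to 2↔Bool) (finToFun-funToFin (Inverse.from 2↔Bool ∘ h) n))
    (Inverse.strictlyInverseˡ 2↔Bool (h n))

-- Pigeonhole: there is one label more than there are truth vectors for `α 0`, ..., `α (m - 1)`.
labels-collide : ∀ m (α : Subst) → ∃ λ i → ∃ λ j → i < suc (2 ^ m) × ¬ i ≡ j ×
  (∀ {n} → n < m → does (classical? (labelled i) (α n)) ≡ does (classical? (labelled j) (α n)))
labels-collide m α =
  let i , j , i<j , e = pigeonhole (n<1+n (2 ^ m)) (encode ∘ truth)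
  in toℕ i , toℕ j , toℕ<n i , <⇒≢ i<j , λ {n} n<m →
       subst (λ x → does (classical? (labelled (toℕ i)) (α x)) ≡ does (classical? (labelled (toℕ j)) (α x)))
         (toℕ-fromℕ< n<m) (encode-injective (truth i) (truth j) e (fromℕ< n<m))
  where
  truth : Fin (suc (2 ^ m)) → Fin m → Bool
  truth i n = does (classical? (labelled (toℕ i)) (α (toℕ n)))

size : Subst → ℕ
size σ = suc (2 ^ (bound (σ 0) ⊔ bound (σ 1)))

-- Take two labels that `α` confuses on all variables of `σ 0` and `σ 1`, and put them on the
-- tripod. Pulled back along `α`, it no longer separates `x₁` from `x₂`, so folding makes the root
-- decide `σ 1`. Through the equivalences in `e` this contradicts `tripod-bump`.
ForkDecides⇒⋡bump : ∀ σ τ → ForkDecides (σ 0) (σ 1) → ¬ σ ≽ bump (size σ) τ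
ForkDecides⇒⋡bump σ τ dec (α , e) with labels-collide (bound (σ 0) ⊔ bound (σ 1)) α
... | i , j , i<k , i≢j , same = proj₂ (tripod-bump (size σ) τ i<k i≢j) (decided
        (ForkDecides-3fork (σ 0) (σ 1) dec (pull 𝔉₃ α V) (pull-monotone 𝔉₃ α mono)
          (AllVars-map same′ (allVars<⊔ˡ (σ 0) (bound (σ 1))))
          (AllVars-map same′ (allVars<⊔ʳ (bound (σ 0)) (σ 1)))
          (to (forces-pull 𝔉₃ α V (σ 0) ρ)
            (proj₂ (at 0) ρ refl≤ (proj₁ (tripod-bump (size σ) τ i<k i≢j))))))
  where
  V : Valuation 𝔉₃
  V = tripod (labelled i) (labelled j) blank
  mono : Monotone 𝔉₃ V
  mono = tripod-monotone (labelled i) (labelled j) blank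
  at : ∀ n → forces 𝔉₃ V ρ (sub α (σ n) ⇔ bump (size σ) τ n)
  at n = proj₂ (e n) V mono ρ
  same′ : ∀ {n} → n < bound (σ 0) ⊔ bound (σ 1) → pull 𝔉₃ α V n x₁ ≡ pull 𝔉₃ α V n x₂
  same′ {n} n<m = trans (pull-maximal 𝔉₃ α V (λ { _ refl≤ → refl }) n)
    (trans (same n<m) (sym (pull-maximal 𝔉₃ α V (λ { _ refl≤ → refl }) n)))
  decided : forces 𝔉₃ (pull 𝔉₃ α V) ρ (σ 1 ∨ neg (σ 1)) →
    forces 𝔉₃ V ρ (bump (size σ) τ 1 ∨ neg (bump (size σ) τ 1))
  decided h with from (forces-pull 𝔉₃ α V (σ 1 ∨ neg (σ 1)) ρ) h
  ... | inj₁ q  = inj₁ (proj₁ (at 1) ρ refl≤ q)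
  ... | inj₂ ¬q = inj₂ λ v le q → ¬q v le (proj₂ (at 1) v le q)

-- Shrinking a complete set.

bot-unifier : Unifier target (λ _ → bot)
bot-unifier = ForkDecides⇒Unifier (λ _ → bot) λ _ _ ()

-- An instance of `σ 0` is equivalent to `bot`, so the truth values of `α` at any leaf refute `σ 0`.
≽bot⇒Refutable : ∀ σ → σ ≽ (λ _ → bot) → Refutable (σ 0)
≽bot⇒Refutable σ (α , e) = v , λ h →
  proj₁ (proj₂ (e 0) V (λ _ _ _ _ ()) x₁) x₁ refl≤
    (from (forces-pull 𝔉₃ α V (σ 0) x₁)
      (from (maximal⟺Classical 𝔉₃ (pull 𝔉₃ α V) (λ { _ refl≤ → refl }) (σ 0)) h))
  where
  V : Valuation 𝔉₃
  V _ _ = false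
  v : ℕ → Bool
  v n = pull 𝔉₃ α V n x₁

no-minimal-complete : ¬ (Σ SubstSet λ S → MinimalComplete target S)
no-minimal-complete (S , (sound , cover) , minimal) = minimal (S′ , (S′⊆S , σ , Sσ , σ∉S′) , sound′ , cover′)
  where
  σ : Subst
  -- Covering the constant `bot` substitution ensures that the member to be dropped has a refutable
  -- first value.
  σ = proj₁ (cover (λ _ → bot) bot-unifier)
  Sσ : S σ
  Sσ = proj₁ (proj₂ (cover (λ _ → bot) bot-unifier))
  σ-refutable : Refutable (σ 0)
  σ-refutable = ≽bot⇒Refutable σ (proj₂ (proj₂ (cover (λ _ → bot) bot-unifier)))
  bumped : Subst → Subst
  bumped = bump (size σ)
  bumped-unifier : ∀ τ → Unifier target τ → Refutable (τ 0) → Unifier target (bumped τ)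
  bumped-unifier τ u ref = ForkDecides⇒Unifier (bumped τ)
    (bump-ForkDecides (size σ) τ (refutable-unifier⇒ForkDecides τ u ref))
  S′ : SubstSet
  -- Irrefutable members stay. Of the others, only those remain that `cover` picks for some bumped
  -- unifier; `σ` is not among them, as it is not above any `bumped τ`.
  S′ ε = (S ε × ¬ Refutable (ε 0)) ⊎
    (∃ λ τ → Σ (Unifier target τ) λ u → Σ (Refutable (τ 0)) λ ref →
      proj₁ (cover (bumped τ) (bumped-unifier τ u ref)) ≡ ε)
  S′⊆S : S′ ⊆ S
  S′⊆S ε (inj₁ (Sε , _)) = Sε
  S′⊆S ε (inj₂ (τ , u , ref , refl)) = proj₁ (proj₂ (cover (bumped τ) (bumped-unifier τ u ref)))
  σ∉S′ : ¬ S′ σ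
  σ∉S′ (inj₁ (_ , irr)) = irr σ-refutable
  σ∉S′ (inj₂ (τ , u , ref , e)) =
    ForkDecides⇒⋡bump σ τ (refutable-unifier⇒ForkDecides σ (sound σ Sσ) σ-refutable)
      (subst (_≽ bumped τ) e (proj₂ (proj₂ (cover (bumped τ) (bumped-unifier τ u ref)))))
  sound′ : ∀ ε → S′ ε → Unifier target ε
  sound′ ε = sound ε ∘′ S′⊆S ε
  cover′ : ∀ μ → Unifier target μ → ∃ λ ε → S′ ε × ε ≽ μ
  cover′ μ u with cover μ u
  ... | τ , Sτ , τ≽μ with refutable? (τ 0)
  ...   | no irr  = τ , inj₁ (Sτ , irr) , τ≽μ
  -- The member `τ` may have been dropped; the chain `ε ≽ bumped τ ≽ τ ≽ μ` provides a replacement.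
  ...   | yes ref =
    let τ-unifier = sound τ Sτ
        ε , _ , ε≽bumped = cover (bumped τ) (bumped-unifier τ τ-unifier ref)
    in ε , inj₂ (τ , τ-unifier , ref , refl) ,
       ≽-trans {ε} {bumped τ} {μ} ε≽bumped (≽-trans {bumped τ} {τ} {μ} (bump≽ (size σ) τ) τ≽μ)

theorem5p9 : Unification.Nullary L
theorem5p9 = target , ((λ _ → bot) , bot-unifier) , no-minimal-complete
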